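{- Let $G$ be a permutation graph with a fixed permutation representation $(<_1,<_2)$. Then the orientation $\triangleleft$ of the compatibility graph $H_G$ determined by this representation is transitive: for all vertices $e,f,g$ of $H_G$, if $e\triangleleft f$ and $f\triangleleft g$, then $eg$ is an edge of $H_G$ and $e\triangleleft g$.
   Context: All graphs are finite, simple and undirected. A permutation representation of $G$ is a pair of linear orders $<_1,<_2$ on $V(G)$ such that two vertices are adjacent in $G$ precisely when they occur in opposite orders in $<_1$ and $<_2$; $G$ is a permutation graph if it has one. Define the strict partial order $\prec$ on $V(G)$ by $u\prec v$ if and only if $u<_1 v$ and $u<_2 v$. Thus distinct vertices are nonadjacent in $G$ exactly when they are comparable under $\prec$. The compatibility graph $H_G$ has as vertices the ordered edges $(c,\ell)$ with $c\ell\in E(G)$ (each edge gives two ordered edges). Two distinct ordered edges $(c,\ell)$ and $(d,r)$ are adjacent in $H_G$ if and only if they are compatible, i.e. either (same centre) $c=d$, $\ell\ne r$ and $\ell r\notin E(G)$; or (different centres) $c\neq d$, the four vertices $c,\ell,d,r$ are distinct, and $cd,cr,\ell d,\ell r\notin E(G)$. Each edge of $H_G$ is given exactly one direction by $\triangleleft$ as follows. For adjacent $(c,\ell)$ and $(c,r)$ with the same centre: $(c,\ell)\triangleleft(c,r)$ if $\ell\prec r$, and $(c,r)\triangleleft(c,\ell)$ if $r\prec\ell$. For adjacent $(c,\ell)$ and $(d,r)$ with $c\ne d$: one of the pairs $\{c,\ell\}$, $\{d,r\}$ is completely before the other under $\prec$; $(c,\ell)\triangleleft(d,r)$ if $c\prec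 d$, $c\prec r$, $\ell\prec d$ and $\ell\prec r$, and otherwise (when $d\prec c$, $d\prec\ell$, $r\prec c$, $r\prec\ell$) $(d,r)\triangleleft(c,\ell)$. -}

module Defs where

open import Data.Empty using (⊥; ⊥-elim)
open import Data.Fin.Base using (Fin)
open import Data.List.Base using ([]; _∷_)
open import Data.List.Relation.Unary.All using ([]; _∷_)
open import Data.List.Relation.Unary.AllPairs using ([]; _∷_)
open import Data.List.Relation.Unary.Unique.Propositional using (Unique)
open import Data.Nat.Base using (ℕ)
open import Data.Product.Base using (∃; _×_; _,_)
open import Data.Sum.Base using (_⊎_; inj₁; inj₂; [_,_]′)
open import Function.Base using (_∘_)
open import Function.Bundles using (_↔_; _⇔_; Equivalence)
open import Level using (0ℓ)
open import Relation.Binary.Core using (Rel)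
open import Relation.Binary.Definitions
  using (Symmetric; Irreflexive; Transitive; Asymmetric; tri<; tri≈; tri>)
open import Relation.Binary.PropositionalEquality
  using (_≡_; _≢_; sym; ≢-sym)
open import Relation.Binary.Structures using (IsStrictTotalOrder)
open import Relation.Nullary.Negation using (¬_)

Finite : Set → Set
Finite A = ∃ λ (n : ℕ) → A ↔ Fin n

record Graph : Set₁ where
  infix 4 _~_
  field
    Vertex   : Set
    _~_      : Rel Vertex 0ℓ
    ~-sym    : Symmetric _~_
    ~-irrefl : Irreflexive _≡_ _~_

record PermutationRepresentation (G : Graph) : Set₁ where
  open Graph G
  infix 4 _<₁_ _<₂_ _≺_
  field
    _<₁_ _<₂_             : Rel Vertex 0ℓ
    <₁-isStrictTotalOrder : IsStrictTotalOrder _≡_ _<₁_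
    <₂-isStrictTotalOrder : IsStrictTotalOrder _≡_ _<₂_
    adjacent⇔inverted     : ∀ u v →
      u ~ v ⇔ ((u <₁ v × v <₂ u) ⊎ (v <₁ u × u <₂ v))

  _≺_ : Rel Vertex 0ℓ
  u ≺ v = u <₁ v × u <₂ v

-- The proof of adjacency is irrelevant, so that ordered edges are equal
-- exactly when their centres and their leaves are.
record OrderedEdge (G : Graph) : Set where
  constructor orderedEdge
  open Graph G
  field
    centre leaf : Vertex
    .adjacent   : centre ~ leaf

module _ (G : Graph) where
  open Graph G
  open OrderedEdge

  SameCentreCompatible : Rel (OrderedEdge G) 0ℓ
  SameCentreCompatible e f =
    centre e ≡ centre f × leaf e ≢ leaf f × ¬ (leaf e ~ leaf f)

  DifferentCentresCompatible : Rel (OrderedEdge G) 0ℓ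
  DifferentCentresCompatible e f =
    centre e ≢ centre f ×
    Unique (centre e ∷ leaf e ∷ centre f ∷ leaf f ∷ []) ×
    ¬ (centre e ~ centre f) × ¬ (centre e ~ leaf f) ×
    ¬ (leaf e ~ centre f) × ¬ (leaf e ~ leaf f)

  Compatible : Rel (OrderedEdge G) 0ℓ
  Compatible e f = SameCentreCompatible e f ⊎ DifferentCentresCompatible e f

  Compatible-sym : Symmetric Compatible
  Compatible-sym (inj₁ (c≡d , ℓ≢r , ℓ≁r)) =
    inj₁ (sym c≡d , ≢-sym ℓ≢r , ℓ≁r ∘ ~-sym)
  Compatible-sym
    (inj₂ ( c≢d
          , ((cℓ ∷ cd ∷ cr ∷ []) ∷ (ℓd ∷ ℓr ∷ []) ∷ (dr ∷ []) ∷ [] ∷ [])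
          , c≁d , c≁r , ℓ≁d , ℓ≁r )) =
    inj₂ ( ≢-sym c≢d
         , ((dr ∷ ≢-sym cd ∷ ≢-sym ℓd ∷ []) ∷ (≢-sym cr ∷ ≢-sym ℓr ∷ [])
            ∷ (cℓ ∷ []) ∷ [] ∷ [])
         , c≁d ∘ ~-sym , ℓ≁d ∘ ~-sym , c≁r ∘ ~-sym , ℓ≁r ∘ ~-sym )

  compatibilityGraph : Graph
  compatibilityGraph = record
    { Vertex   = OrderedEdge G
    ; _~_      = λ e f → e ≢ f × Compatible e f
    ; ~-sym    = λ {e} {f} (e≢f , compat) → ≢-sym e≢f , Compatible-sym {e} {f} compat
    ; ~-irrefl = λ e≡f (e≢f , _) → e≢f e≡f
    }

module _ {G : Graph} (P : PermutationRepresentation G) where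
  open Graph G
  open PermutationRepresentation P
  open OrderedEdge
  open Graph (compatibilityGraph G) using () renaming (_~_ to _~ᴴ_)

  CompletelyBefore : Rel (OrderedEdge G) 0ℓ
  CompletelyBefore e f =
    centre e ≺ centre f × centre e ≺ leaf f ×
    leaf e ≺ centre f × leaf e ≺ leaf f

  -- The second clause of each case of the definition is the first one with
  -- the two ordered edges exchanged, so a single clause suffices.
  Orientation : Rel (OrderedEdge G) 0ℓ
  Orientation e f =
    e ~ᴴ f ×
    ( (centre e ≡ centre f × leaf e ≺ leaf f)
    ⊎ (centre e ≢ centre f × CompletelyBefore e f))

  infix 4 Orientation
  syntax Orientation P e f = e ◁[ P ] f

  private
    module O₁ = IsStrictTotalOrder <₁-isStrictTotalOrder
    module O₂ = IsStrictTotalOrder <₂-isStrictTotalOrder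

  ≺-trans : Transitive _≺_
  ≺-trans (p , q) (p′ , q′) = O₁.trans p p′ , O₂.trans q q′

  ≺-asym : Asymmetric _≺_
  ≺-asym (p , _) (q , _) = O₁.asym p q

  ≺⇒≁ : ∀ {u v} → u ≺ v → ¬ (u ~ v)
  ≺⇒≁ {u} {v} (p , q) u~v with Equivalence.to (adjacent⇔inverted u v) u~v
  ... | inj₁ (_ , q′) = O₂.asym q q′
  ... | inj₂ (p′ , _) = O₁.asym p p′

  ≁⇒comparable : ∀ {u v} → u ≢ v → ¬ (u ~ v) → u ≺ v ⊎ v ≺ u
  ≁⇒comparable {u} {v} u≢v u≁v with O₁.compare u v | O₂.compare u v
  ... | tri≈ _ u≡v _ | _            = ⊥-elim (u≢v u≡v)
  ... | _            | tri≈ _ u≡v _ = ⊥-elim (u≢v u≡v)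
  ... | tri< p _ _   | tri< q _ _   = inj₁ (p , q)
  ... | tri> _ _ p   | tri> _ _ q   = inj₂ (p , q)
  ... | tri< p _ _   | tri> _ _ q   =
    ⊥-elim (u≁v (Equivalence.from (adjacent⇔inverted u v) (inj₁ (p , q))))
  ... | tri> _ _ p   | tri< q _ _   =
    ⊥-elim (u≁v (Equivalence.from (adjacent⇔inverted u v) (inj₂ (p , q))))

  private
    no-between : ∀ {u v w} → .(u ~ v) → u ≺ w → ¬ (w ≺ v)
    no-between u~v u≺w w≺v = ⊥-irr (≺⇒≁ (≺-trans u≺w w≺v) u~v)
      where
      ⊥-irr : .⊥ → ⊥
      ⊥-irr ()

    before : ∀ e f → DifferentCentresCompatible G e f →
             centre e ≺ centre f → CompletelyBefore e f
    before (orderedEdge c ℓ c~ℓ) (orderedEdge d r d~r)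
      (_ , ((_ ∷ _ ∷ c≢r ∷ []) ∷ (ℓ≢d ∷ ℓ≢r ∷ []) ∷ _)
         , _ , c≁r , ℓ≁d , ℓ≁r) c≺d = c≺d , c≺r , ℓ≺d , ℓ≺r
      where
      c≺r : c ≺ r
      c≺r with ≁⇒comparable c≢r c≁r
      ... | inj₁ p = p
      ... | inj₂ p = ⊥-elim (no-between (~-sym d~r) p c≺d)
      ℓ≺d : ℓ ≺ d
      ℓ≺d with ≁⇒comparable ℓ≢d ℓ≁d
      ... | inj₁ p = p
      ... | inj₂ p = ⊥-elim (no-between c~ℓ c≺d p)
      ℓ≺r : ℓ ≺ r
      ℓ≺r with ≁⇒comparable ℓ≢r ℓ≁r
      ... | inj₁ p = p
      ... | inj₂ p = ⊥-elim (no-between c~ℓ c≺r p)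

  -- Together with Orientation-asym: every edge of the compatibility graph
  -- receives exactly one direction.
  Orientation-total : ∀ {e f} → e ~ᴴ f → Orientation e f ⊎ Orientation f e
  Orientation-total {e} {f} (e≢f , inj₁ same@(c≡d , ℓ≢r , ℓ≁r)) =
    [ (λ p → inj₁ ((e≢f , inj₁ same) , inj₁ (c≡d , p)))
    , (λ p → inj₂ ( (≢-sym e≢f , Compatible-sym G {e} {f} (inj₁ same))
                  , inj₁ (sym c≡d , p)))
    ]′ (≁⇒comparable ℓ≢r ℓ≁r)
  Orientation-total {e} {f} (e≢f , inj₂ diff@(c≢d , _ , c≁d , _))
    with ≁⇒comparable c≢d c≁d
  ... | inj₁ c≺d = inj₁ ((e≢f , inj₂ diff) , inj₂ (c≢d , before e f diff c≺d))
  ... | inj₂ d≺c with Compatible-sym G {e} {f} (inj₂ diff)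
  ...   | inj₁ (d≡c , _)   = ⊥-elim (c≢d (sym d≡c))
  ...   | inj₂ diff′ =
    inj₂ ((≢-sym e≢f , inj₂ diff′) , inj₂ (≢-sym c≢d , before f e diff′ d≺c))

  Orientation-asym : Asymmetric Orientation
  Orientation-asym (_ , inj₁ (_ , p))       (_ , inj₁ (_ , q))       = ≺-asym p q
  Orientation-asym (_ , inj₁ (c≡d , _))     (_ , inj₂ (d≢c , _))     = d≢c (sym c≡d)
  Orientation-asym (_ , inj₂ (c≢d , _))     (_ , inj₁ (d≡c , _))     = c≢d (sym d≡c)
  Orientation-asym (_ , inj₂ (_ , (p , _))) (_ , inj₂ (_ , (q , _))) = ≺-asym p q

{-# OPTIONS --safe #-}
module Submission where

open import Defs
open import Data.Empty using (⊥-elim-irr)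
open import Data.List.Relation.Unary.All using ([]; _∷_)
open import Data.List.Relation.Unary.AllPairs using ([]; _∷_)
open import Data.Product.Base using (_×_; _,_; proj₁)
open import Data.Sum.Base using (inj₁; inj₂)
open import Relation.Binary.PropositionalEquality using (_≡_; _≢_; refl; cong)

-- An `≺` between two vertices makes them both distinct and nonadjacent, so the comparisons defining
-- a direction already force compatibility (`leaf≺⇒◁`, `completelyBefore⇒◁`). Only comparisons have
-- to be composed, by transitivity of `≺`: two same-centre steps give a same-centre step, and any
-- other combination puts the first edge completely before the last.

module _ {G : Graph} where
  open Graph G
  open OrderedEdge

  centre≢leaf : (e : OrderedEdge G) → centre e ≢ leaf e
  centre≢leaf (orderedEdge _ _ c~ℓ) c≡ℓ = ⊥-elim-irr (~-irrefl c≡ℓ c~ℓ)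

  module _ (P : PermutationRepresentation G) where
    open PermutationRepresentation P

    ≺⇒≢ : ∀ {u v} → u ≺ v → u ≢ v
    ≺⇒≢ u≺u refl = ≺-asym P u≺u u≺u

    leaf≺⇒◁ : ∀ {e f} → centre e ≡ centre f → leaf e ≺ leaf f → e ◁[ P ] f
    leaf≺⇒◁ c≡d ℓ≺r =
      ( (λ e≡f → ≺⇒≢ ℓ≺r (cong leaf e≡f))
      , inj₁ (c≡d , ≺⇒≢ ℓ≺r , ≺⇒≁ P ℓ≺r) )
      , inj₁ (c≡d , ℓ≺r)

    -- The four comparisons separate the vertices of `e` from those of `f`; within each edge, centre
    -- and leaf differ because `G` has no loops.
    completelyBefore⇒◁ : ∀ {e f} → CompletelyBefore P e f → e ◁[ P ] f
    completelyBefore⇒◁ {e} {f} before@(c≺d , c≺r , ℓ≺d , ℓ≺r) =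
      ( (λ e≡f → c≢d (cong centre e≡f))
      , inj₂ ( c≢d
             , ( (centre≢leaf e ∷ c≢d ∷ ≺⇒≢ c≺r ∷ [])
               ∷ (≺⇒≢ ℓ≺d ∷ ≺⇒≢ ℓ≺r ∷ [])
               ∷ (centre≢leaf f ∷ []) ∷ [] ∷ [] )
             , ≺⇒≁ P c≺d , ≺⇒≁ P c≺r , ≺⇒≁ P ℓ≺d , ≺⇒≁ P ℓ≺r ) )
      , inj₂ (c≢d , before)
      where
      c≢d : centre e ≢ centre f
      c≢d = ≺⇒≢ c≺d

    ◁-trans : ∀ {e f g} → e ◁[ P ] f → f ◁[ P ] g → e ◁[ P ] g
    ◁-trans (_ , inj₁ (refl , ℓ≺r)) (_ , inj₁ (refl , r≺s)) =
      leaf≺⇒◁ refl (≺-trans P ℓ≺r r≺s)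
    -- The shared centre keeps its comparisons; the leaf of `e` inherits those of the leaf of `f`,
    -- which lies above it.
    ◁-trans (_ , inj₁ (refl , ℓ≺r)) (_ , inj₂ (_ , c≺d , c≺s , r≺d , r≺s)) =
      completelyBefore⇒◁ (c≺d , c≺s , ≺-trans P ℓ≺r r≺d , ≺-trans P ℓ≺r r≺s)
    ◁-trans (_ , inj₂ (_ , c≺d , c≺r , ℓ≺d , ℓ≺r)) (_ , inj₁ (refl , r≺s)) =
      completelyBefore⇒◁ (c≺d , ≺-trans P c≺r r≺s , ℓ≺d , ≺-trans P ℓ≺r r≺s)
    -- All four comparisons pass through the centre of the middle edge `f`.
    ◁-trans (_ , inj₂ (_ , c≺d , _ , ℓ≺d , _)) (_ , inj₂ (_ , d≺b , d≺s , _ , _)) =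
      completelyBefore⇒◁ ( ≺-trans P c≺d d≺b , ≺-trans P c≺d d≺s
                         , ≺-trans P ℓ≺d d≺b , ≺-trans P ℓ≺d d≺s )

lemma4 : (G : Graph) → Finite (Graph.Vertex G) →
    (P : PermutationRepresentation G) →
    (e f g : Graph.Vertex (compatibilityGraph G)) →
    e ◁[ P ] f → f ◁[ P ] g →
    Graph._~_ (compatibilityGraph G) e g × e ◁[ P ] g
lemma4 G _ P e f g e◁f f◁g = proj₁ e◁g , e◁g
  where
  e◁g : e ◁[ P ] g
  e◁g = ◁-trans P e◁f f◁g
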